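{- Let $G$ be a connected $r$-regular graph which is not a complete graph of odd order. Then $G$ has an IPD.
   Context: All graphs are finite and simple. $G$ is $r$-regular if every vertex has degree $r$. A subgraph $H$ of $G$ is induced if for all $u,v\in V(H)$, $uv\in E(H)$ iff $uv\in E(G)$. An induced path decomposition of $G$ is a set of pairwise vertex-disjoint paths covering all vertices of $G$, each of which is an induced subgraph of $G$. $G$ has an IPD if it has an induced path decomposition in which every path has order (number of vertices) at least $2$. -}

module Defs where

open import Data.Nat using (ℕ; zero; suc; _≤_)
open import Data.Nat.Properties using ()
open import Data.Bool using (Bool; true; false; if_then_else_)
open import Data.Fin using (Fin; toℕ)
open import Data.List using (List; length; map; allFin; concat; lookup)
open import Data.Nat.ListAction using (sum)
open import Data.List.Relation.Unary.All using (All)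
open import Data.List.Relation.Unary.Unique.Propositional using (Unique)
open import Data.List.Relation.Binary.Permutation.Propositional using (_↭_)
open import Data.Product using (Σ; _×_)
open import Data.Sum using (_⊎_)
open import Data.Empty using (⊥)
open import Relation.Nullary using (¬_)
open import Relation.Binary.PropositionalEquality using (_≡_)
open import Function.Bundles using (_⇔_)

record Graph : Set where
  field
    n     : ℕ
    adj   : Fin n → Fin n → Bool
    sym   : ∀ u v → adj u v ≡ adj v u
    irrefl : ∀ v → adj v v ≡ false
open Graph public

Adj : (G : Graph) → Fin (n G) → Fin (n G) → Set
Adj G u v = adj G u v ≡ true

degree : (G : Graph) → Fin (n G) → ℕ
degree G v = sum (map (λ u → if adj G v u then 1 else 0) (allFin (n G)))

Regular : (G : Graph) → ℕ → Set
Regular G r = ∀ v → degree G v ≡ r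

data Reach (G : Graph) : Fin (n G) → Fin (n G) → Set where
  here : ∀ {u} → Reach G u u
  step : ∀ {u w v} → Adj G u w → Reach G w v → Reach G u v

Connected : Graph → Set
Connected G = ∀ u v → Reach G u v

Odd : ℕ → Set
Odd m = Σ ℕ λ k → m ≡ suc (k Data.Nat.+ k)

Complete : Graph → Set
Complete G = ∀ u v → ¬ (u ≡ v) → Adj G u v

-- A list of vertices p = (p₀,…,p_{k-1}) is an induced path of G iff its
-- vertices are distinct and p_i ~ p_j exactly when |i - j| = 1.
-- (This says both that consecutive vertices are adjacent, i.e. it is a path,
-- and that no other pair is adjacent, i.e. the path is an induced subgraph.)
IsInducedPath : (G : Graph) → List (Fin (n G)) → Set
IsInducedPath G p =
  Unique p ×
  (∀ (i j : Fin (length p)) →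
     Adj G (lookup p i) (lookup p j) ⇔ (suc (toℕ i) ≡ toℕ j ⊎ suc (toℕ j) ≡ toℕ i))

-- Induced path decomposition: paths are pairwise vertex-disjoint and cover
-- every vertex exactly once, i.e. their concatenation is a permutation of V(G).
IsIPD : (G : Graph) → List (List (Fin (n G))) → Set
IsIPD G ps = All (IsInducedPath G) ps × (concat ps ↭ allFin (n G))

HasIPD : Graph → Set
HasIPD G = Σ (List (List (Fin (n G)))) λ ps →
  IsIPD G ps × All (λ p → 2 ≤ length p) ps

{-# OPTIONS --safe #-}
module Submission where

-- Call a set good if it splits into edges and induced three-vertex paths. Starting from all
-- vertices as single vertices, the number of singles is lowered one by one, in the style of
-- an alternating forest search. From a single vertex one grows a set H made of centres S and
-- of 2|S| + 1 classes, such that H minus any one class, H minus any two classes, and any class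
-- minus any one of its vertices are good. Hence H ∖ u is good for every u in a class, and an
-- edge from an active u to another class or another single removes a single.
-- If u meets an induced path at an end, or meets its middle x and also an end, a single is
-- removed as well; if u meets only the middle x of y x z, then x becomes a centre and {y}, {z}
-- become new classes. An edge x y met by u either removes a single or is absorbed into the
-- class of u: the class is tracked only as an odd clique B hanging off an older part at one
-- vertex c, the active vertices being those of B ∖ c.
-- When nothing is possible, the neighbours of active vertices lie in S ∪ B. Unless G itself is
-- an odd complete graph, |B| ≤ r, and then each class sends at least r/2 edges to S, which
-- gives (2|S| + 1) r ≤ 2 r |S|, a contradiction.

open import Defs
open import Algebra.Solver.CommutativeMonoid using ()
open import Data.Bool using (true; false; if_then_else_)
open import Data.Bool.Properties as Bool using ()
open import Data.Empty using (⊥-elim)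
open import Data.Fin using (Fin; zero; suc)
open import Data.List using (List; []; _∷_; [_]; _++_; length; map; concatMap; allFin)
open import Data.List.Properties using (++-identityʳ; concatMap-++; map-++; length-tabulate)
open import Data.List.Membership.Propositional using (_∈_)
open import Data.List.Membership.Propositional.Properties using (∈-++⁻; ∈-++⁺ʳ; ∈-allFin)
open import Data.List.Relation.Binary.Permutation.Propositional
  using (_↭_; prep; ↭-swap; ↭-refl; ↭-sym; ↭-trans; ↭-reflexive; ↭⇒↭ₛ)
open import Data.List.Relation.Binary.Permutation.Propositional.Properties
  using (++-commutativeMonoid; ++⁺; ++⁺ˡ; ++⁺ʳ; ↭-length; map⁺; All-resp-↭; ∈-resp-↭; drop-∷)
open import Data.List.Relation.Binary.Permutation.Setoid.Properties as ↭ₛ using ()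
open import Data.List.Relation.Unary.All as All using (All; []; _∷_)
open import Data.List.Relation.Unary.All.Properties as All using ()
open import Data.List.Relation.Unary.Any using (here; there)
open import Data.List.Relation.Unary.AllPairs using ([]; _∷_)
open import Data.List.Relation.Unary.Unique.Propositional using (Unique)
open import Data.List.Relation.Unary.Unique.Propositional.Properties using (allFin⁺)
open import Data.Nat using (ℕ; zero; suc; _+_; _*_; _≤_; z≤n; s≤s; s≤s⁻¹; _≤?_)
open import Data.Nat.ListAction using (sum)
open import Data.Nat.ListAction.Properties using (sum-++; sum-↭)
open import Data.Nat.Properties
open import Data.Nat.Solver using (module +-*-Solver)
open import Data.Product using (∃; ∃₂; _×_; _,_; proj₁; proj₂)
open import Data.Sum using (_⊎_; inj₁; inj₂)
open import Function using (id; case_of_; mk⇔)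
open import Relation.Binary.PropositionalEquality as ≡ using (_≡_; refl; cong; cong₂)
open import Relation.Nullary using (¬_; Dec; yes; no; ¬?; decidable-stable; contradiction)

open +-*-Solver using (_:+_; _:*_; _:=_; con) renaming (solve to solveℕ)

-- Removing one occurrence from a list

data Pick {A : Set} (x : A) : List A → List A → Set where
  here  : ∀ {xs} → Pick x (x ∷ xs) xs
  there : ∀ {y xs ys} → Pick x xs ys → Pick x (y ∷ xs) (y ∷ ys)

module _ {A : Set} where

  pick-↭ : ∀ {x : A} {xs ys} → Pick x xs ys → xs ↭ x ∷ ys
  pick-↭ here      = ↭-refl
  pick-↭ (there p) = ↭-trans (prep _ (pick-↭ p)) (_↭_.swap _ _ ↭-refl)

  pick-length : ∀ {x : A} {xs ys} → Pick x xs ys → length xs ≡ suc (length ys)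
  pick-length p = ↭-length (pick-↭ p)

  ∈-pick : ∀ {x : A} {xs} → x ∈ xs → ∃ (Pick x xs)
  ∈-pick (here refl) = _ , here
  ∈-pick (there x∈)  = _ , there (proj₂ (∈-pick x∈))

  pick-∈ : ∀ {x : A} {xs ys} → Pick x xs ys → x ∈ xs
  pick-∈ here      = here refl
  pick-∈ (there p) = there (pick-∈ p)

  pick-swap : ∀ {x y : A} {xs ys zs} → Pick x xs ys → Pick y ys zs →
    ∃ λ ws → Pick y xs ws × Pick x ws zs
  pick-swap here      q    = _ , there q , here
  pick-swap (there p) here = _ , here , p
  pick-swap (there p) (there q) with pick-swap p q
  ... | _ , q′ , p′ = _ , there q′ , there p′

  pick-++⁻ : ∀ {x : A} xs {ys zs} → Pick x (xs ++ ys) zs →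
    (∃ λ xs′ → Pick x xs xs′ × zs ≡ xs′ ++ ys) ⊎ (∃ λ ys′ → Pick x ys ys′ × zs ≡ xs ++ ys′)
  pick-++⁻ []       p         = inj₂ (_ , p , refl)
  pick-++⁻ (x ∷ xs) here      = inj₁ (_ , here , refl)
  pick-++⁻ (x ∷ xs) (there p) with pick-++⁻ xs p
  ... | inj₁ (_ , q , refl) = inj₁ (_ , there q , refl)
  ... | inj₂ (_ , q , refl) = inj₂ (_ , q , refl)

  pick-++⁺ˡ : ∀ {x : A} {xs xs′ ys} → Pick x xs xs′ → Pick x (xs ++ ys) (xs′ ++ ys)
  pick-++⁺ˡ here      = here
  pick-++⁺ˡ (there p) = there (pick-++⁺ˡ p)

  pick-++⁺ʳ : ∀ {x : A} xs {ys ys′} → Pick x ys ys′ → Pick x (xs ++ ys) (xs ++ ys′)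
  pick-++⁺ʳ []       p = p
  pick-++⁺ʳ (x ∷ xs) p = there (pick-++⁺ʳ xs p)

  -- Runs a test at every position: `X` is the outcome that ends the search, and `P` is what is
  -- known locally once no position yields `X`.
  search : ∀ {X : Set} {xs : List A} {P : A → List A → Set} →
    (∀ {x ys} → Pick x xs ys → X ⊎ P x ys) → X ⊎ (∀ {x ys} → Pick x xs ys → P x ys)
  search {xs = []}     f = inj₂ λ ()
  search {xs = x ∷ xs} f with f here | search (λ p → f (there p))
  ... | inj₁ a | _      = inj₁ a
  ... | inj₂ _ | inj₁ a = inj₁ a
  ... | inj₂ b | inj₂ g = inj₂ λ { here → b ; (there p) → g p }

  find : ∀ {P : A → Set} → (∀ x → Dec (P x)) → ∀ xs →
    (∃₂ λ x ys → Pick x xs ys × P x) ⊎ All (λ x → ¬ P x) xs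
  find P? []       = inj₂ []
  find P? (x ∷ xs) with P? x | find P? xs
  ... | yes px | _                      = inj₁ (_ , _ , here , px)
  ... | no _   | inj₁ (_ , _ , p , py)  = inj₁ (_ , _ , there p , py)
  ... | no ¬px | inj₂ none              = inj₂ (¬px ∷ none)

  pick-All : ∀ {P : A → Set} {x xs ys} → All P xs → Pick x xs ys → P x
  pick-All (px ∷ _)  here      = px
  pick-All (_ ∷ pxs) (there p) = pick-All pxs p

  tabulate-pick : ∀ {P : A → Set} {xs} → (∀ {x ys} → Pick x xs ys → P x) → All P xs
  tabulate-pick {xs = []}    f = []
  tabulate-pick {xs = _ ∷ _} f = f here ∷ tabulate-pick (λ p → f (there p))

  unique-↭ : ∀ {xs ys : List A} → xs ↭ ys → Unique xs → Unique ys
  unique-↭ p = ↭ₛ.Unique-resp-↭ (≡.setoid A) (↭⇒↭ₛ p)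

module _ {A B : Set} (f : A → List B) where

  pick-concatMap : ∀ {b} xs {bs} → Pick b (concatMap f xs) bs →
    ∃₂ λ x xs′ → Pick x xs xs′ × ∃ (Pick b (f x))
  pick-concatMap (x ∷ xs) p with pick-++⁻ (f x) p
  ... | inj₁ (_ , q , _) = _ , _ , here , _ , q
  ... | inj₂ (_ , q , _) with pick-concatMap xs q
  ...   | _ , _ , p′ , q′ = _ , _ , there p′ , q′

  pick-concatMap-↭ : ∀ {x xs ys} → Pick x xs ys →
    concatMap f xs ↭ f x ++ concatMap f ys
  pick-concatMap-↭ here = ↭-refl
  pick-concatMap-↭ {x} {y ∷ _} {y ∷ ys} (there p) =
    ↭-trans (++⁺ˡ (f y) (pick-concatMap-↭ p))
      (solve 3 (λ a b c → a ⊕ b ⊕ c ⊜ b ⊕ a ⊕ c) ↭-refl (f y) (f x) (concatMap f ys))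
    where open Algebra.Solver.CommutativeMonoid (++-commutativeMonoid {A = B}) using (solve; _⊕_; _⊜_)

data Even : ℕ → Set where
  zero : Even 0
  2+_  : ∀ {m} → Even m → Even (suc (suc m))

even-pred₂ : ∀ {m} → Even (suc (suc m)) → Even m
even-pred₂ (2+ e) = e

even⇒odd-suc : ∀ {m} → Even m → Odd (suc m)
even⇒odd-suc zero   = 0 , refl
even⇒odd-suc (2+ e) with even⇒odd-suc e
... | k , eq = suc k , cong suc (≡.trans (cong suc eq) (cong suc (≡.sym (+-suc k k))))

-- Vertex lists that split into edges and induced three-vertex paths

module _ (G : Graph) where

  V : Set
  V = Fin (n G)

  infix 4 _~_ _~?_
  _~_ : V → V → Set
  _~_ = Adj G

  _~?_ : ∀ u v → Dec (u ~ v)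
  u ~? v = adj G u v Bool.≟ true

  ~-sym : ∀ {u v} → u ~ v → v ~ u
  ~-sym {u} {v} uv = ≡.trans (Graph.sym G v u) uv

  open Algebra.Solver.CommutativeMonoid (++-commutativeMonoid {A = V}) using (solve; _⊕_; _⊜_)

  -- x ≢ z for paths is recovered at the end, from the uniqueness of allFin.
  data Piece : Set where
    edge : ∀ x y → x ~ y → Piece
    path : ∀ x y z → x ~ y → y ~ z → ¬ x ~ z → Piece

  piece : Piece → List V
  piece (edge x y _)         = x ∷ y ∷ []
  piece (path x y z _ _ _)   = x ∷ y ∷ z ∷ []

  pieces : List Piece → List V
  pieces = concatMap piece

  Good : List V → Set
  Good xs = ∃ λ ps → pieces ps ↭ xs

  good-[] : Good []
  good-[] = [] , ↭-refl

  good-↭ : ∀ {xs ys} → xs ↭ ys → Good xs → Good ys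
  good-↭ p (ps , q) = ps , ↭-trans q p

  good-edge : ∀ {x y zs} → x ~ y → Good zs → Good (x ∷ y ∷ zs)
  good-edge xy (ps , q) = edge _ _ xy ∷ ps , prep _ (prep _ q)

  good-path : ∀ {x y z zs} → x ~ y → y ~ z → ¬ x ~ z → Good zs → Good (x ∷ y ∷ z ∷ zs)
  good-path xy yz xz (ps , q) = path _ _ _ xy yz xz ∷ ps , prep _ (prep _ (prep _ q))

  good-++ : ∀ {xs ys} → Good xs → Good ys → Good (xs ++ ys)
  good-++ (ps , q) (ps′ , q′) = ps ++ ps′ , ↭-trans (↭-reflexive (concatMap-++ piece ps ps′)) (++⁺ q q′)

  -- Cliques and their matchings

  Clique : List V → Set
  Clique B = ∀ {w E} → Pick w B E → All (w ~_) E

  clique-[] : Clique []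
  clique-[] ()

  clique-∷ : ∀ {x B} → All (x ~_) B → Clique B → Clique (x ∷ B)
  clique-∷ xB cl here      = xB
  clique-∷ xB cl (there p) = ~-sym (pick-All xB p) ∷ cl p

  clique-pick : ∀ {u A A′} → Clique A → Pick u A A′ → Clique A′
  clique-pick cl p q with pick-swap p q
  ... | _ , q′ , p′ =
    tabulate-pick λ s → pick-All (cl q′) (proj₁ (proj₂ (pick-swap p′ s)))

  -- Pairing off consecutive entries gives a perfect matching.
  clique-good : ∀ {A} → Even (length A) → Clique A → Good A
  clique-good {[]}        _      _  = good-[]
  clique-good {a ∷ b ∷ A} (2+ e) cl with cl here
  ... | ab ∷ _ = good-edge ab (clique-good e (clique-pick (clique-pick cl here) here))

  even-pick₂ : ∀ {a b : V} {A A′ A″} → Even (length A) → Pick a A A′ → Pick b A′ A″ →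
    Even (length A″)
  even-pick₂ e p q =
    even-pred₂ (≡.subst Even (≡.trans (pick-length p) (cong suc (pick-length q))) e)

  clique-good₂ : ∀ {a b A A′ A″} → Even (length A) → Clique A → Pick a A A′ → Pick b A′ A″ → Good A″
  clique-good₂ e cl p q = clique-good (even-pick₂ e p q) (clique-pick (clique-pick cl p) q)

  odd-pick : ∀ {A : List V} → Even (suc (length A)) → ∃₂ λ z A′ → Pick z A A′
  odd-pick {z ∷ A} _ = z , A , here

  -- Factor-critical sets and classes

  -- The analogue of factor-criticality, with edges and induced three-vertex paths in place of
  -- matching edges.
  Factor : List V → Set
  Factor T = ∀ {w E} → Pick w T E → Good E

  factor-↭ : ∀ {S T} → S ↭ T → Factor S → Factor T
  factor-↭ p f q with ∈-pick (∈-resp-↭ (↭-sym p) (pick-∈ q))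
  ... | _ , q′ = good-↭ (drop-∷ (↭-trans (↭-sym (pick-↭ q′)) (↭-trans p (pick-↭ q)))) (f q′)

  -- In big c D A …, the clique is c ∷ A and the older part is c ∷ D; only A is active.
  data Class : Set where
    solo : V → Class
    big  : ∀ c D A → Factor (c ∷ D) → Clique (c ∷ A) → Even (length A) → 1 ≤ length A →
           All (λ a → All (λ d → ¬ a ~ d) D) A → Class

  verts act : Class → List V
  verts (solo v)                = [ v ]
  verts (big c D A _ _ _ _ _)   = c ∷ D ++ A
  act (solo v)                  = [ v ]
  act (big c D A _ _ _ _ _)     = A

  act⊆verts : ∀ T {u A′} → Pick u (act T) A′ → ∃ (Pick u (verts T))
  act⊆verts (solo v)              p = _ , p
  act⊆verts (big c D A _ _ _ _ _) p = _ , there (pick-++⁺ʳ D p)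

  -- For `big`, two sets of this kind are glued at `c`: the older part `c ∷ D` and the odd clique
  -- `c ∷ A`. The side that loses a vertex other than `c` keeps `c`, and the other side does without
  -- it.
  factor : ∀ T → Factor (verts T)
  factor (solo v) here = good-[]
  factor (big c D A f cl e _ _) here =
    good-++ (f here) (clique-good e (clique-pick cl here))
  factor (big c D A f cl e _ _) (there p) with pick-++⁻ D p
  ... | inj₁ (_ , q , refl) = good-++ (f (there q)) (clique-good e (clique-pick cl here))
  ... | inj₂ (A′ , q , refl) =
    good-↭ (solve 3 (λ c D A′ → D ⊕ c ⊕ A′ ⊜ c ⊕ D ⊕ A′) ↭-refl [ c ] D A′)
      (good-++ (f here) (clique-good (even-∷ (pick-length q)) (clique-pick cl (there q))))
    where
    even-∷ : ∀ {m} → length A ≡ m → Even m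
    even-∷ eq = ≡.subst Even eq e

  -- Absorbing an outside edge into a class

  Twin : V → V → V → Set
  Twin x y w = (w ~ x × w ~ y) ⊎ (¬ w ~ x × ¬ w ~ y)

  -- If `w` sees exactly one end of the edge, then `w` and the edge form an induced path, and the
  -- rest of `T` is good without `w`.
  twins : ∀ {T x y} → Factor T → x ~ y → Good (T ++ x ∷ y ∷ []) ⊎ All (Twin x y) T
  twins {T} {x} {y} f xy with search decide
    where
    decide : ∀ {w E} → Pick w T E → Good (T ++ x ∷ y ∷ []) ⊎ Twin x y w
    decide {w} {E} p with w ~? x | w ~? y
    ... | yes wx | yes wy = inj₂ (inj₁ (wx , wy))
    ... | no wx  | no wy  = inj₂ (inj₂ (wx , wy))
    ... | yes wx | no wy  = inj₁ (good-↭ (↭-trans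
            (solve 4 (λ w x y E → w ⊕ x ⊕ y ⊕ E ⊜ (w ⊕ E) ⊕ x ⊕ y) ↭-refl [ w ] [ x ] [ y ] E)
            (++⁺ʳ _ (↭-sym (pick-↭ p)))) (good-path wx xy wy (f p)))
    ... | no wx  | yes wy = inj₁ (good-↭ (↭-trans
            (solve 4 (λ w x y E → w ⊕ y ⊕ x ⊕ E ⊜ (w ⊕ E) ⊕ x ⊕ y) ↭-refl [ w ] [ x ] [ y ] E)
            (++⁺ʳ _ (↭-sym (pick-↭ p)))) (good-path wy (~-sym xy) wx (f p)))
  ... | inj₁ g = inj₁ g
  ... | inj₂ t = inj₂ (tabulate-pick t)

  twin-yes : ∀ {x y w} → Twin x y w → w ~ x → w ~ y
  twin-yes (inj₁ (_ , wy)) _  = wy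
  twin-yes (inj₂ (¬wx , _)) wx = ⊥-elim (¬wx wx)

  twin-no : ∀ {x y w} → Twin x y w → ¬ w ~ x → ¬ w ~ y
  twin-no (inj₁ (wx , _)) ¬wx = ⊥-elim (¬wx wx)
  twin-no (inj₂ (_ , ¬wy)) _  = ¬wy

  -- By `twins`, `x` and `y` may be assumed to have the same neighbours in the class. For `big`,
  -- either these allow a direct splitting, or they are `u` alone or exactly `c ∷ A`. Then a new
  -- clique hangs off `u`, or `x` and `y` join the old one.
  absorb : ∀ T {u x y A′} → Pick u (act T) A′ → u ~ x → x ~ y →
    Good (verts T ++ x ∷ y ∷ []) ⊎ ∃ λ T⁺ → verts T⁺ ↭ verts T ++ x ∷ y ∷ []
  absorb T p ux xy with twins (factor T) xy
  ... | inj₁ g = inj₁ g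
  absorb (solo v) {x = x} {y} here vx xy | inj₂ (t ∷ []) =
    -- `v`, `x` and `y` form a triangle.
    inj₂ (big v [] (x ∷ y ∷ []) (λ { here → good-[] ; (there ()) })
      (clique-∷ (vx ∷ twin-yes t vx ∷ []) (clique-∷ (xy ∷ []) (clique-∷ [] clique-[])))
      (2+ zero) (s≤s z≤n) ([] ∷ [] ∷ []) , ↭-refl)
  absorb T@(big c D A f cl e ne na) {u} {x} {y} {A′} pu ux xy | inj₂ tw = noD (search killD)
    where
    Goal = Good (verts T ++ x ∷ y ∷ []) ⊎ ∃ λ T⁺ → verts T⁺ ↭ verts T ++ x ∷ y ∷ []

    clA : Clique A
    clA = clique-pick cl here

    uT : verts T ↭ u ∷ c ∷ D ++ A′
    uT = ↭-trans (prep c (++⁺ˡ D (pick-↭ pu)))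
           (solve 4 (λ c D u A′ → c ⊕ D ⊕ u ⊕ A′ ⊜ u ⊕ c ⊕ D ⊕ A′) ↭-refl [ c ] D [ u ] A′)

    tw′ : All (Twin x y) (u ∷ c ∷ D ++ A′)
    tw′ = All-resp-↭ uT tw

    twB : All (Twin x y) (c ∷ A′)
    twB = All.head (All.tail tw′) ∷ All.++⁻ʳ D (All.tail (All.tail tw′))

    uA′ : All (u ~_) A′
    uA′ = clA pu

    -- `A` has even order and contains `u`, so `A′` is not empty.
    first : ∃₂ λ z A″ → Pick z A′ A″
    first = odd-pick (≡.subst Even (pick-length pu) e)

    -- A neighbour `w` of `x` in `D` can be taken out of the older part. To leave an even clique in
    -- `A`, both `u` and a second vertex `z` are used.
    killD : ∀ {w D′} → Pick w D D′ → Good (verts T ++ x ∷ y ∷ []) ⊎ (¬ w ~ x)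
    killD {w} {D′} pw with w ~? x | first
    ... | no wx | _ = inj₂ wx
    ... | yes wx | z , A″ , pz with z ~? x
    -- Path `x u z` and edge `y w`.
    ...   | no zx = inj₁ (good-↭ (↭-trans
              (solve 8 (λ c w D′ u z A″ x y → x ⊕ u ⊕ z ⊕ y ⊕ w ⊕ A″ ⊕ c ⊕ D′ ⊜
                  (c ⊕ (w ⊕ D′) ⊕ u ⊕ z ⊕ A″) ⊕ x ⊕ y) ↭-refl
                  [ c ] [ w ] D′ [ u ] [ z ] A″ [ x ] [ y ])
              (++⁺ʳ _ (prep c (++⁺ (↭-sym (pick-↭ pw))
                (↭-trans (prep u (↭-sym (pick-↭ pz))) (↭-sym (pick-↭ pu)))))))
            (good-path (~-sym ux) (pick-All uA′ pz) (λ xz → zx (~-sym xz))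
              (good-edge (~-sym (twin-yes (pick-All tw (there (pick-++⁺ˡ pw))) wx))
                (good-++ (clique-good₂ e clA pu pz) (f (there pw))))))
    -- Path `u x w`, induced because `A` has no edge to `D`, and edge `y z`.
    ...   | yes zx = inj₁ (good-↭ (↭-trans
              (solve 8 (λ c w D′ u z A″ x y → u ⊕ x ⊕ w ⊕ y ⊕ z ⊕ A″ ⊕ c ⊕ D′ ⊜
                  (c ⊕ (w ⊕ D′) ⊕ u ⊕ z ⊕ A″) ⊕ x ⊕ y) ↭-refl
                  [ c ] [ w ] D′ [ u ] [ z ] A″ [ x ] [ y ])
              (++⁺ʳ _ (prep c (++⁺ (↭-sym (pick-↭ pw))
                (↭-trans (prep u (↭-sym (pick-↭ pz))) (↭-sym (pick-↭ pu)))))))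
            (good-path ux (~-sym wx) (pick-All (pick-All na pu) pw)
              (good-edge (~-sym (twin-yes (pick-All tw′ (there (there (pick-++⁺ʳ D pz)))) zx))
                (good-++ (clique-good₂ e clA pu pz) (f (there pw))))))

    noD : Good (verts T ++ x ∷ y ∷ []) ⊎ (∀ {w D′} → Pick w D D′ → ¬ w ~ x) → Goal
    noD (inj₁ g) = inj₁ g
    noD (inj₂ Dx) with find (_~? x) (c ∷ A′)
    -- Only `u` meets the edge: the triangle on `u`, `x`, `y` becomes the clique, and the whole
    -- former class becomes the older part, attached at `u`.
    noD (inj₂ Dx) | inj₂ (cx ∷ A′x) =
      inj₂ (big u (c ∷ D ++ A′) (x ∷ y ∷ []) fac
        (clique-∷ (ux ∷ twin-yes (All.head tw′) ux ∷ []) (clique-∷ (xy ∷ []) (clique-∷ [] clique-[])))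
        (2+ zero) (s≤s z≤n)
        (All.map (λ wx xw → wx (~-sym xw)) nx ∷
         All.zipWith (λ { (t , wx) yw → twin-no t wx (~-sym yw) }) (All.tail tw′ , nx) ∷ []) ,
        ++⁺ʳ _ (↭-sym uT))
      where
      nx : All (λ w → ¬ w ~ x) (c ∷ D ++ A′)
      nx = cx ∷ All.++⁺ (tabulate-pick Dx) A′x
      fac : Factor (u ∷ c ∷ D ++ A′)
      fac = factor-↭ uT (factor T)
    noD (inj₂ Dx) | inj₁ (v , B₁ , pv , vx) with find (λ z → ¬? (z ~? x)) B₁
    -- Path `z u x` and edge `y v`. The odd clique `c ∷ A` loses `u`, `v` and `z`, so an even clique
    -- remains.
    ... | inj₁ (z , B₂ , pz , zx) = inj₁ (good-↭ (↭-trans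
            (solve 7 (λ D u v z B₂ x y → z ⊕ u ⊕ x ⊕ y ⊕ v ⊕ B₂ ⊕ D ⊜
               (u ⊕ D ⊕ v ⊕ z ⊕ B₂) ⊕ x ⊕ y) ↭-refl D [ u ] [ v ] [ z ] B₂ [ x ] [ y ])
            (++⁺ʳ _ (↭-trans (prep u (↭-trans
               (++⁺ˡ D (↭-trans (prep v (↭-sym (pick-↭ pz))) (↭-sym (pick-↭ pv))))
               (solve 3 (λ c D A′ → D ⊕ c ⊕ A′ ⊜ c ⊕ D ⊕ A′) ↭-refl [ c ] D A′)))
               (↭-sym uT))))
          (good-path (~-sym (pick-All (cl (there pu)) (proj₁ (proj₂ (pick-swap pv pz))))) ux zx
            (good-edge (~-sym (twin-yes (pick-All twB pv) vx))
              (good-++ (clique-good₂ (≡.subst Even (pick-length pu) e)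
                          (clique-pick cl (there pu)) pv pz) (f here)))))
    -- All of `c ∷ A` sees `x`, hence `y`: the clique grows by two and stays odd.
    ... | inj₂ allx = inj₂ (big c D (x ∷ y ∷ A) f
          (clique-∷ (All.head xB ∷ All.head yB ∷ cl here)
            (clique-∷ (xy ∷ All.map ~-sym (All.tail xB)) (clique-∷ (All.map ~-sym (All.tail yB)) clA)))
          (2+ e) (s≤s z≤n)
          (All.map (λ wx xw → wx (~-sym xw)) nx ∷
           All.zipWith (λ { (t , wx) yw → twin-no t wx (~-sym yw) }) (All.++⁻ˡ D (All.tail tw) , nx) ∷ na) ,
          solve 5 (λ c D A x y → c ⊕ D ⊕ x ⊕ y ⊕ A ⊜ (c ⊕ D ⊕ A) ⊕ x ⊕ y) ↭-refl [ c ] D A [ x ] [ y ])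
      where
      nx : All (λ w → ¬ w ~ x) D
      nx = tabulate-pick Dx
      xB : All (_~ x) (c ∷ A)
      xB = All-resp-↭ (↭-trans (_↭_.swap u c ↭-refl) (prep c (↭-sym (pick-↭ pu))))
             (ux ∷ All-resp-↭ (↭-sym (pick-↭ pv)) (vx ∷ All.map (decidable-stable (_ ~? x)) allx))
      yB : All (_~ y) (c ∷ A)
      yB = All.zipWith (λ { (t , wx) → twin-yes t wx })
             ((All.head tw ∷ All.++⁻ʳ D (All.tail tw)) , xB)

  -- States of the search

  all-verts : List Class → List V
  all-verts = concatMap verts

  Partition : ℕ → Set
  Partition k = ∃₂ λ sg ps → length sg ≤ k × sg ++ pieces ps ↭ allFin (n G)

  good-partition : ∀ {k X} sg → length sg ≤ k → Good X → sg ++ X ↭ allFin (n G) → Partition k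
  good-partition sg l (ps , q) p = sg , ps , l , ↭-trans (++⁺ˡ sg q) p

  -- sg and ps are the singles and pieces outside H, where H is S together with the classes Ts.
  record State (k m : ℕ) : Set where
    constructor state
    field
      S     : List V
      Ts    : List Class
      sg    : List V
      ps    : List Piece
      total : S ++ all-verts Ts ++ sg ++ pieces ps ↭ allFin (n G)
      size  : length Ts ≡ suc (length S + length S)
      sg≤   : length sg ≤ k
      ps≡   : length ps ≡ m
      good₁ : ∀ {T Ts′} → Pick T Ts Ts′ → Good (S ++ all-verts Ts′)
      good₂ : ∀ {T U Ts′ Ts″} → Pick T Ts Ts′ → Pick U Ts′ Ts″ → Good (S ++ all-verts Ts″)

  -- In a state, `k` bounds the singles other than the root of `H`, so `Partition k` means that a
  -- single is gone. Otherwise a piece outside `H` has been used up, which makes `m` the termination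
  -- measure.
  Progress : ℕ → ℕ → Set
  Progress k m = Partition k ⊎ ∃ λ m′ → m ≡ suc m′ × State k m′

  -- Steps from an active vertex

  data Hit (w : V) (p : Piece) : Set where
    edge : ∀ {y} → w ~ y → piece p ↭ w ∷ y ∷ [] → Hit w p
    end  : ∀ {y z} → y ~ z → piece p ↭ w ∷ y ∷ z ∷ [] → Hit w p
    mid  : ∀ {y z} → w ~ y → w ~ z → ¬ y ~ z → piece p ↭ w ∷ y ∷ z ∷ [] → Hit w p

  hit : ∀ p {w E} → Pick w (piece p) E → Hit w p
  hit (edge x y xy)         here                 = edge xy ↭-refl
  hit (edge x y xy)         (there here)         = edge (~-sym xy) (↭-swap x y ↭-refl)
  hit (path x y z xy yz xz) here                 = end yz ↭-refl
  hit (path x y z xy yz xz) (there here)         = mid (~-sym xy) yz xz (↭-swap x y ↭-refl)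
  hit (path x y z xy yz xz) (there (there here)) =
    end xy (solve 3 (λ x y z → x ⊕ y ⊕ z ⊜ z ⊕ x ⊕ y) ↭-refl [ x ] [ y ] [ z ])

  module _ {k m} (st : State k m) where
    open State st

    -- By `total`, this leaves only `S` and the class of `u` for the neighbours of `u`.
    Stuck : V → List Class → Set
    Stuck u Ts′ = All (λ x → ¬ u ~ x) (all-verts Ts′ ++ sg ++ pieces ps)

    module _ {T Ts′ u A′} (pT : Pick T Ts Ts′) (pu : Pick u (act T) A′) where

      W E P : List V
      W = all-verts Ts′
      E = proj₁ (act⊆verts T pu)
      P = pieces ps

      pE : Pick u (verts T) E
      pE = proj₂ (act⊆verts T pu)

      total-T : S ++ (verts T ++ W) ++ sg ++ P ↭ allFin (n G)
      total-T = ↭-trans (++⁺ˡ S (++⁺ʳ _ (↭-sym (pick-concatMap-↭ verts pT)))) total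

      total-u : S ++ ((u ∷ E) ++ W) ++ sg ++ P ↭ allFin (n G)
      total-u = ↭-trans (++⁺ˡ S (++⁺ʳ (sg ++ P) (++⁺ʳ W (↭-sym (pick-↭ pE))))) total-T

      EW-good : Good (E ++ S ++ W)
      EW-good = good-++ (factor T pE) (good₁ pT)

      -- The edge `u x` takes one vertex from each of two classes. Both are good without it, and
      -- `good₂` covers the rest of `H`.
      class-kill : ∀ {x X} → u ~ x → Pick x W X → Partition k
      class-kill {x} ux px with pick-concatMap verts Ts′ px
      ... | U , Ts″ , pU , F , pF = good-partition sg sg≤
        (good-edge ux (good-++ (factor T pE) (good-++ (factor U pF)
          (good-++ (good₂ pT pU) (ps , ↭-refl)))))
        (↭-trans
          (↭-trans
            (solve 8 (λ u x E F S W″ sg P → sg ⊕ u ⊕ x ⊕ E ⊕ F ⊕ (S ⊕ W″) ⊕ P ⊜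
               S ⊕ ((u ⊕ E) ⊕ (x ⊕ F) ⊕ W″) ⊕ sg ⊕ P) ↭-refl
               [ u ] [ x ] E F S (all-verts Ts″) sg P)
            (++⁺ˡ S (++⁺ʳ (sg ++ P) (++⁺ˡ (u ∷ E)
              (↭-trans (++⁺ʳ (all-verts Ts″) (↭-sym (pick-↭ pF)))
                       (↭-sym (pick-concatMap-↭ verts pU)))))))
          total-u)

      single-kill : ∀ {x X} → u ~ x → Pick x sg X → Partition k
      single-kill {x} {X} ux px = good-partition X
        -- The edge also uses up a single of `sg`, so fewer than `k` remain; only the bound `k` is
        -- claimed.
        (≤-trans (n≤1+n _) (≤-trans (≤-reflexive (≡.sym (pick-length px))) sg≤))
        (good-edge ux (good-++ EW-good (ps , ↭-refl)))
        (↭-trans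
          (↭-trans
            (solve 7 (λ u x E S W X P → X ⊕ u ⊕ x ⊕ (E ⊕ S ⊕ W) ⊕ P ⊜
               S ⊕ ((u ⊕ E) ⊕ W) ⊕ (x ⊕ X) ⊕ P) ↭-refl [ u ] [ x ] E S W X P)
            (++⁺ˡ S (++⁺ˡ ((u ∷ E) ++ W) (++⁺ʳ P (↭-sym (pick-↭ px))))))
          total-u)

      module _ {p ps′} (pp : Pick p ps ps′) where

        P′ : List V
        P′ = pieces ps′

        P↭ : piece p ++ P′ ↭ P
        P↭ = ↭-sym (pick-concatMap-↭ piece pp)

        -- `H` without `T` is good by `good₁`, so only `sg` remains single.
        kill : Good (verts T ++ piece p) → Progress k m
        kill g = inj₁ (good-partition sg sg≤
          (good-++ g (good-++ (good₁ pT) (ps′ , ↭-refl)))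
          (↭-trans
            (↭-trans
              (solve 6 (λ T p S W sg P′ → sg ⊕ (T ⊕ p) ⊕ (S ⊕ W) ⊕ P′ ⊜
                 S ⊕ (T ⊕ W) ⊕ sg ⊕ (p ⊕ P′)) ↭-refl (verts T) (piece p) S W sg P′)
              (++⁺ˡ S (++⁺ˡ (verts T ++ W) (++⁺ˡ sg P↭))))
            total-T))

        kill-u : Good (u ∷ piece p) → Progress k m
        kill-u g = kill (good-↭
          (↭-trans (solve 3 (λ u p E → (u ⊕ p) ⊕ E ⊜ (u ⊕ E) ⊕ p) ↭-refl [ u ] (piece p) E)
                   (++⁺ʳ (piece p) (↭-sym (pick-↭ pE))))
          (good-++ g (factor T pE)))

        grow-class : ∀ {x y} → x ~ y → piece p ↭ x ∷ y ∷ [] →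
          ∀ T⁺ → verts T⁺ ↭ verts T ++ x ∷ y ∷ [] → State k (length ps′)
        grow-class {x} {y} xy p↭ T⁺ T⁺↭ = state S (T⁺ ∷ Ts′) sg ps′
          (↭-trans
            (↭-trans (++⁺ˡ S (++⁺ʳ (sg ++ P′) (++⁺ʳ W (↭-trans T⁺↭ (++⁺ˡ (verts T) (↭-sym p↭))))))
              (↭-trans
                (solve 6 (λ T p S W sg P′ → S ⊕ ((T ⊕ p) ⊕ W) ⊕ sg ⊕ P′ ⊜
                   S ⊕ (T ⊕ W) ⊕ sg ⊕ (p ⊕ P′)) ↭-refl (verts T) (piece p) S W sg P′)
                (++⁺ˡ S (++⁺ˡ (verts T ++ W) (++⁺ˡ sg P↭)))))
            total-T)
          (≡.trans (≡.sym (pick-length pT)) size) sg≤ refl g₁ g₂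
          where
          -- Wherever `T` was covered, the edge `x y` is added to cover `T⁺`.
          extend : ∀ {Y X} → Good (S ++ all-verts Y) → Pick T Y X →
            Good (S ++ verts T⁺ ++ all-verts X)
          extend {Y} {X} g q = good-↭
            (↭-trans (prep x (prep y (++⁺ˡ S (pick-concatMap-↭ verts q))))
              (↭-trans
                (solve 5 (λ x y S T X → x ⊕ y ⊕ S ⊕ T ⊕ X ⊜ S ⊕ (T ⊕ x ⊕ y) ⊕ X) ↭-refl
                   [ x ] [ y ] S (verts T) (all-verts X))
                (++⁺ˡ S (++⁺ʳ (all-verts X) (↭-sym T⁺↭)))))
            (good-edge xy g)

          g₁ : ∀ {U X} → Pick U (T⁺ ∷ Ts′) X → Good (S ++ all-verts X)
          g₁ here      = good₁ pT
          g₁ (there q) with pick-swap pT q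
          ... | _ , q′ , pT′ = extend (good₁ q′) pT′

          g₂ : ∀ {U U′ X X′} → Pick U (T⁺ ∷ Ts′) X → Pick U′ X X′ → Good (S ++ all-verts X′)
          g₂ here      q    = good₂ pT q
          g₂ (there q) here = good₂ pT q
          g₂ (there q) (there r) with pick-swap pT q
          ... | _ , q′ , pT′ with pick-swap pT′ r
          ...   | _ , r′ , pT″ = extend (good₂ q′ r′) pT″

        -- If an old class is removed, `x` is covered together with whatever remains of `y` and `z`.
        -- If all old classes stay, `x` also takes `u` from its class, which is good without it.
        grow-tree : ∀ {x y z} → u ~ x → x ~ y → x ~ z → ¬ u ~ y → ¬ u ~ z → ¬ y ~ z →
          piece p ↭ x ∷ y ∷ z ∷ [] → State k (length ps′)
        grow-tree {x} {y} {z} ux xy xz uy uz yz p↭ =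
          state (x ∷ S) (solo y ∷ solo z ∷ Ts) sg ps′
          (↭-trans
            (↭-trans
              (solve 7 (λ x y z S Ts sg P′ → (x ⊕ S) ⊕ (y ⊕ z ⊕ Ts) ⊕ sg ⊕ P′ ⊜
                 S ⊕ Ts ⊕ sg ⊕ ((x ⊕ y ⊕ z) ⊕ P′)) ↭-refl
                 [ x ] [ y ] [ z ] S (all-verts Ts) sg P′)
              (++⁺ˡ S (++⁺ˡ (all-verts Ts) (++⁺ˡ sg (↭-trans (++⁺ʳ P′ (↭-sym p↭)) P↭)))))
            total)
          -- Two new classes for one new centre preserve `2|S| + 1`.
          (cong (λ l → suc (suc l)) (≡.trans size (≡.sym (+-suc (length S) (length S)))))
          sg≤ refl g₁ g₂
          where
          Ts↭ : u ∷ E ++ W ↭ all-verts Ts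
          Ts↭ = ↭-trans (++⁺ʳ W (↭-sym (pick-↭ pE))) (↭-sym (pick-concatMap-↭ verts pT))

          leave : ∀ {a} → x ~ a → ¬ u ~ a → Good (x ∷ S ++ a ∷ all-verts Ts)
          leave {a} xa ua = good-↭
            (↭-trans
              (solve 6 (λ x a u E S W → u ⊕ x ⊕ a ⊕ E ⊕ S ⊕ W ⊜ (x ⊕ S) ⊕ a ⊕ (u ⊕ E ⊕ W)) ↭-refl
                 [ x ] [ a ] [ u ] E S W)
              (++⁺ˡ (x ∷ S) (prep a Ts↭)))
            (good-path ux xa ua EW-good)

          leave₂ : Good (x ∷ S ++ all-verts Ts)
          leave₂ = good-↭
            (↭-trans
              (solve 5 (λ x u E S W → u ⊕ x ⊕ E ⊕ S ⊕ W ⊜ (x ⊕ S) ⊕ (u ⊕ E ⊕ W)) ↭-refl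
                 [ x ] [ u ] E S W)
              (++⁺ˡ (x ∷ S) Ts↭))
            (good-edge ux EW-good)

          add-edge : ∀ {a X} → x ~ a → Good (S ++ X) → Good (x ∷ S ++ a ∷ X)
          add-edge {a} {X} xa g = good-↭
            (solve 4 (λ x a S X → x ⊕ a ⊕ S ⊕ X ⊜ (x ⊕ S) ⊕ a ⊕ X) ↭-refl [ x ] [ a ] S X)
            (good-edge xa g)

          add-path : ∀ {X} → Good (S ++ X) → Good (x ∷ S ++ y ∷ z ∷ X)
          add-path {X} g = good-↭
            (solve 5 (λ x y z S X → y ⊕ x ⊕ z ⊕ S ⊕ X ⊜ (x ⊕ S) ⊕ y ⊕ z ⊕ X) ↭-refl
               [ x ] [ y ] [ z ] S X)
            (good-path (~-sym xy) xz yz g)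

          g₁ : ∀ {U X} → Pick U (solo y ∷ solo z ∷ Ts) X → Good (x ∷ S ++ all-verts X)
          g₁ here              = leave xz uz
          g₁ (there here)      = leave xy uy
          g₁ (there (there q)) = add-path (good₁ q)

          g₂ : ∀ {U U′ X X′} → Pick U (solo y ∷ solo z ∷ Ts) X → Pick U′ X X′ →
            Good (x ∷ S ++ all-verts X′)
          g₂ here              here              = leave₂
          g₂ here              (there q)         = add-edge xz (good₁ q)
          g₂ (there here)      here              = leave₂
          g₂ (there here)      (there q)         = add-edge xy (good₁ q)
          g₂ (there (there q)) here              = add-edge xz (good₁ q)
          g₂ (there (there q)) (there here)      = add-edge xy (good₁ q)
          g₂ (there (there q)) (there (there r)) = add-path (good₂ q r)

        next : State k (length ps′) → Progress k m
        next s = inj₂ (_ , ≡.trans (≡.sym ps≡) (pick-length pp) , s)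

        piece-progress : ∀ {x} → u ~ x → Hit x p → Progress k m
        piece-progress {x} ux (edge {y} xy p↭) with absorb T pu ux xy
        ... | inj₁ g            = kill (good-↭ (++⁺ˡ (verts T) (↭-sym p↭)) g)
        ... | inj₂ (T⁺ , T⁺↭)   = next (grow-class xy p↭ T⁺ T⁺↭)
        -- `x` is an end of the path, so the edges `u x` and `y z` cover all four vertices.
        piece-progress ux (end yz p↭) =
          kill-u (good-↭ (prep u (↭-sym p↭)) (good-edge ux (good-edge yz good-[])))
        piece-progress {x} ux (mid {y} {z} xy xz yz p↭) with u ~? y | u ~? z
        ... | yes uy | _ = kill-u (good-↭
          (↭-trans (solve 4 (λ u x y z → u ⊕ y ⊕ x ⊕ z ⊜ u ⊕ x ⊕ y ⊕ z) ↭-refl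
                      [ u ] [ x ] [ y ] [ z ])
                   (prep u (↭-sym p↭)))
          (good-edge uy (good-edge xz good-[])))
        ... | no _ | yes uz = kill-u (good-↭
          (↭-trans (solve 4 (λ u x y z → u ⊕ z ⊕ x ⊕ y ⊜ u ⊕ x ⊕ y ⊕ z) ↭-refl
                      [ u ] [ x ] [ y ] [ z ])
                   (prep u (↭-sym p↭)))
          (good-edge uz (good-edge xy good-[])))
        -- Now `u x y` and `u x z` are induced, as `grow-tree` requires.
        ... | no uy | no uz = next (grow-tree ux xy xz uy uz yz p↭)

      try : Progress k m ⊎ Stuck u Ts′
      try with find (u ~?_) (W ++ sg ++ P)
      ... | inj₂ none = inj₂ none
      ... | inj₁ (x , _ , px , ux) with pick-++⁻ W px
      ...   | inj₁ (_ , q , _) = inj₁ (inj₁ (class-kill ux q))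
      ...   | inj₂ (_ , q , _) with pick-++⁻ sg q
      ...     | inj₁ (_ , q′ , _) = inj₁ (inj₁ (single-kill ux q′))
      ...     | inj₂ (_ , q′ , _) with pick-concatMap piece ps q′
      ...       | p , _ , pp , _ , px′ = inj₁ (piece-progress pp ux (hit p px′))

    progress : Progress k m ⊎ (∀ {T Ts′} → Pick T Ts Ts′ →
      ∀ {u A′} → Pick u (act T) A′ → Stuck u Ts′)
    progress = search (λ pT → search (λ pu → try pT pu))

  -- Counting neighbours and edges

  count : V → List V → ℕ
  count u xs = sum (map (λ v → if adj G u v then 1 else 0) xs)

  count-++ : ∀ u xs ys → count u (xs ++ ys) ≡ count u xs + count u ys
  count-++ u xs ys = ≡.trans (cong sum (map-++ _ xs ys)) (sum-++ (map _ xs) (map _ ys))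

  count-↭ : ∀ u {xs ys} → xs ↭ ys → count u xs ≡ count u ys
  count-↭ u p = sum-↭ (map⁺ _ p)

  count-none : ∀ {u xs} → All (λ x → ¬ u ~ x) xs → count u xs ≡ 0
  count-none [] = refl
  count-none {u} {x ∷ _} (ux ∷ uxs) with adj G u x
  ... | true  = ⊥-elim (ux refl)
  ... | false = count-none uxs

  none-count : ∀ {u} xs → count u xs ≡ 0 → All (λ x → ¬ u ~ x) xs
  none-count [] _ = []
  none-count {u} (x ∷ xs) eq with adj G u x in ux
  ... | true  = case eq of λ ()
  ... | false = (λ u~x → case ≡.trans (≡.sym ux) u~x of λ ()) ∷ none-count xs eq

  count-all : ∀ {u xs} → All (u ~_) xs → count u xs ≡ length xs
  count-all [] = refl
  count-all {u} {x ∷ _} (ux ∷ uxs) rewrite ux = cong suc (count-all uxs)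

  ~-irrefl : ∀ {u} → ¬ u ~ u
  ~-irrefl {u} uu = case ≡.trans (≡.sym uu) (irrefl G u) of λ ()

  count-self : ∀ u xs → count u (u ∷ xs) ≡ count u xs
  count-self u xs rewrite irrefl G u = refl

  clique-count : ∀ {u B E} → Clique B → Pick u B E → count u B ≡ length E
  clique-count {u} {E = E} cl p =
    ≡.trans (count-↭ u (pick-↭ p)) (≡.trans (count-self u E) (count-all (cl p)))

  cross : List V → List V → ℕ
  cross X Y = sum (map (λ u → count u Y) X)

  cross-++ˡ : ∀ X X′ Y → cross (X ++ X′) Y ≡ cross X Y + cross X′ Y
  cross-++ˡ X X′ Y = ≡.trans (cong sum (map-++ _ X X′)) (sum-++ (map _ X) (map _ X′))

  cross-∷ʳ : ∀ X y Y → cross X (y ∷ Y) ≡ count y X + cross X Y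
  cross-∷ʳ []      y Y = refl
  cross-∷ʳ (x ∷ X) y Y rewrite Graph.sym G x y | cross-∷ʳ X y Y =
    solveℕ 4 (λ a b c d → (a :+ b) :+ (c :+ d) := (a :+ c) :+ (b :+ d)) refl
      (if adj G y x then 1 else 0) (count x Y) (count y X) (cross X Y)

  -- Double counting: symmetry of adjacency lets the edges between `X` and `Y` be counted from
  -- either side.
  cross-comm : ∀ X Y → cross X Y ≡ cross Y X
  cross-comm []      []      = refl
  cross-comm (x ∷ X) []      = cross-comm X []
  cross-comm X       (y ∷ Y) = ≡.trans (cross-∷ʳ X y Y) (cong (count y X +_) (cross-comm X Y))

  cross-lower : ∀ {a X} Y → All (λ u → a ≤ count u Y) X → length X * a ≤ cross X Y
  cross-lower Y []       = z≤n
  cross-lower Y (l ∷ ls) = +-mono-≤ l (cross-lower Y ls)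

  cross-upper : ∀ {a} X Y → (∀ u → count u Y ≤ a) → cross X Y ≤ length X * a
  cross-upper []      Y l = z≤n
  cross-upper (u ∷ X) Y l = +-mono-≤ (l u) (cross-upper X Y l)

  -- The clique and the active vertices of a class

  -- Contains every neighbour that an active vertex has within its class. Unlike `act`, it includes
  -- `c`, so its order is odd as `clique-bound` requires.
  block : Class → List V
  block (solo v)              = [ v ]
  block (big c D A _ _ _ _ _) = c ∷ A

  block-clique : ∀ T → Clique (block T)
  block-clique (solo v)               = clique-∷ [] clique-[]
  block-clique (big c D A _ cl _ _ _) = cl

  block-odd : ∀ T → Odd (length (block T))
  block-odd (solo v)              = even⇒odd-suc zero
  block-odd (big c D A _ _ e _ _) = even⇒odd-suc e

  block-split : ∀ T → ∃ λ R → block T ++ R ↭ verts T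
  block-split (solo v)              = [] , ↭-refl
  block-split (big c D A _ _ _ _ _) =
    D , solve 3 (λ c A D → (c ⊕ A) ⊕ D ⊜ c ⊕ D ⊕ A) ↭-refl [ c ] A D

  block-inhabited : ∀ T → 1 ≤ length (block T)
  block-inhabited (solo v)              = s≤s z≤n
  block-inhabited (big _ _ _ _ _ _ _ _) = s≤s z≤n

  act-inhabited : ∀ T → 1 ≤ length (act T)
  act-inhabited (solo v)               = s≤s z≤n
  act-inhabited (big _ _ _ _ _ _ ne _) = ne

  block≤act : ∀ T → length (block T) ≤ suc (length (act T))
  block≤act (solo v)              = n≤1+n 1
  block≤act (big _ _ _ _ _ _ _ _) = ≤-refl

  act-split : ∀ T → ∃ λ R → act T ++ R ↭ verts T
  act-split (solo v)              = [] , ↭-refl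
  act-split (big c D A _ _ _ _ _) =
    c ∷ D , solve 3 (λ c A D → A ⊕ c ⊕ D ⊜ c ⊕ D ⊕ A) ↭-refl [ c ] A D

  all-act : List Class → List V
  all-act = concatMap act

  all-act-split : ∀ Ts → ∃ λ R → all-act Ts ++ R ↭ all-verts Ts
  all-act-split []       = [] , ↭-refl
  all-act-split (T ∷ Ts) with act-split T | all-act-split Ts
  ... | R , p | Rs , q = R ++ Rs , ↭-trans
    (solve 4 (λ A As R Rs → (A ⊕ As) ⊕ R ⊕ Rs ⊜ (A ⊕ R) ⊕ As ⊕ Rs) ↭-refl
      (act T) (all-act Ts) R Rs) (++⁺ p q)

  -- `u` sees all other vertices of its clique and nothing in `D`; the successor accounts for `u`
  -- itself.
  act-count : ∀ T {u A′} → Pick u (act T) A′ → suc (count u (verts T)) ≡ length (block T)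
  act-count (solo v) here = cong suc (count-self v [])
  act-count (big c D A _ cl _ _ na) {u} {A′} pu = cong suc
    (≡.trans (count-↭ u (solve 3 (λ c A D → c ⊕ D ⊕ A ⊜ (c ⊕ A) ⊕ D) ↭-refl [ c ] A D))
      (≡.trans (count-++ u (c ∷ A) D)
        (≡.trans (cong₂ _+_ (clique-count cl (there pu)) (count-none (pick-All na pu)))
          (≡.trans (+-identityʳ _) (≡.sym (pick-length pu))))))

  -- The degree argument

  module _ {r} (conn : Connected G) (reg : Regular G r) (nc : ¬ (Complete G × Odd (n G))) where

    count-split : ∀ u X {Y} → X ++ Y ↭ allFin (n G) → count u X + count u Y ≡ r
    count-split u X {Y} p = ≡.trans (≡.sym (count-++ u X Y)) (≡.trans (count-↭ u p) (reg u))

    odd-inhabited : ∀ {B : List V} → Odd (length B) → ∃ (_∈ B)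
    odd-inhabited {b ∷ _} _ = b , here refl
    odd-inhabited {[]} (_ , ())

    -- In a clique with more than `r` vertices every vertex already has `r` neighbours inside, so no
    -- edge leaves it. By connectedness it is all of `G`, which `nc` excludes.
    clique-bound : ∀ {B R} → Clique B → Odd (length B) → B ++ R ↭ allFin (n G) → length B ≤ r
    clique-bound {B} {R} cl odd p with length B ≤? r
    ... | yes l = l
    ... | no r<B = ⊥-elim (nc (complete , ≡.subst Odd (size R p) odd))
      where
      isolated : ∀ {w E} → Pick w B E → All (λ x → ¬ w ~ x) R
      isolated {w} {E} q = none-count R (n≤0⇒n≡0 (+-cancelˡ-≤ (length E) _ _ (begin
        length E + count w R  ≡⟨ cong (_+ count w R) (clique-count cl q) ⟨
        count w B + count w R ≡⟨ count-split w B p ⟩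
        r                     ≤⟨ s≤s⁻¹ (≤-trans (≰⇒> r<B) (≤-reflexive (pick-length q))) ⟩
        length E              ≡⟨ +-identityʳ _ ⟨
        length E + 0          ∎)))
        where open ≤-Reasoning

      reach : ∀ {w v} → w ∈ B → Reach G w v → v ∈ B
      reach w∈ here = w∈
      reach w∈ (step {w = v} wv vs) with ∈-++⁻ B (∈-resp-↭ (↭-sym p) (∈-allFin v))
      ... | inj₁ v∈B = reach v∈B vs
      ... | inj₂ v∈R = ⊥-elim (All.lookup (isolated (proj₂ (∈-pick w∈))) v∈R wv)

      covers : ∀ v → v ∈ B
      covers v = reach (proj₂ (odd-inhabited odd)) (conn _ v)

      -- By `covers`, a vertex of `R` would also lie in `B` and so occur twice in `allFin`.
      size : ∀ R → B ++ R ↭ allFin (n G) → length B ≡ n G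
      size [] p = ≡.trans (≡.trans (cong length (≡.sym (++-identityʳ B))) (↭-length p))
                    (length-tabulate id)
      size (x ∷ R) p with ∈-pick (covers x)
      ... | E , q with unique-↭ (↭-trans (↭-sym p) (++⁺ʳ (x ∷ R) (pick-↭ q))) (allFin⁺ (n G))
      ...   | x∉ ∷ _ = ⊥-elim (All.lookup x∉ (∈-++⁺ʳ E (here refl)) refl)

      complete : Complete G
      complete u v u≢v with ∈-pick (covers u)
      ... | E , q with ∈-resp-↭ (pick-↭ q) (covers v)
      ...   | here v≡u = ⊥-elim (u≢v (≡.sym v≡u))
      ...   | there v∈ = All.lookup (cl q) v∈

    -- With b = |block|, p = |act| and r = b + q, every active vertex sends 1 + q edges to S.
    act-cross : ∀ S T → length (block T) ≤ r →
      (∀ {u A′} → Pick u (act T) A′ → suc r ≡ count u S + length (block T)) →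
      r ≤ 2 * cross (act T) S
    act-cross S T b≤r deg with m≤n⇒∃[o]m+o≡n b≤r
    ... | q , refl = begin
      b + q              ≤⟨ bound p (act-inhabited T) (block≤act T) ⟩
      2 * (p * suc q)    ≤⟨ *-monoʳ-≤ 2 (cross-lower S (tabulate-pick λ pu → ≤-reflexive
                              (+-cancelʳ-≡ b (suc q) _
                                (≡.trans (cong suc (+-comm q b)) (deg pu))))) ⟩
      2 * cross (act T) S ∎
      where
      open ≤-Reasoning
      b = length (block T)
      p = length (act T)
      bound : ∀ p → 1 ≤ p → b ≤ suc p → b + q ≤ 2 * (p * suc q)
      bound (suc p) _ b≤ = begin
        b + q                                        ≤⟨ +-monoˡ-≤ q b≤ ⟩
        2 + p + q                                    ≤⟨ m≤m+n _ _ ⟩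
        (2 + p + q) + (p + q + 2 * (p * q))          ≡⟨ solveℕ 2 (λ p q →
            (con 2 :+ p :+ q) :+ (p :+ q :+ con 2 :* (p :* q)) :=
            con 2 :* ((con 1 :+ p) :* (con 1 :+ q))) refl p q ⟩
        2 * (suc p * suc q)                          ∎

    cross-sum : ∀ S Ts → All (λ T → r ≤ 2 * cross (act T) S) Ts →
      length Ts * r ≤ 2 * cross (all-act Ts) S
    cross-sum S []       []       = z≤n
    cross-sum S (T ∷ Ts) (l ∷ ls) = begin
      r + length Ts * r                             ≤⟨ +-mono-≤ l (cross-sum S Ts ls) ⟩
      2 * cross (act T) S + 2 * cross (all-act Ts) S ≡⟨ *-distribˡ-+ 2 (cross (act T) S) _ ⟨
      2 * (cross (act T) S + cross (all-act Ts) S)   ≡⟨ cong (2 *_) (cross-++ˡ (act T) _ S) ⟨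
      2 * cross (all-act (T ∷ Ts)) S                 ∎
      where open ≤-Reasoning

    not-stuck : ∀ {k m} (st : State k m) → let open State st in
      ¬ (∀ {T Ts′} → Pick T Ts Ts′ → ∀ {u A′} → Pick u (act T) A′ → Stuck st u Ts′)
    not-stuck st stuck = contradiction r≤0 (<⇒≱ 1≤r)
      where
      open State st
      open ≤-Reasoning

      rest : List V
      rest = sg ++ pieces ps

      bound : ∀ {T Ts′} → Pick T Ts Ts′ → length (block T) ≤ r
      bound {T} {Ts′} pT with block-split T
      ... | R , p = clique-bound (block-clique T) (block-odd T) (↭-trans
        (↭-trans
          (solve 5 (λ B R S W X → B ⊕ R ⊕ S ⊕ W ⊕ X ⊜ S ⊕ ((B ⊕ R) ⊕ W) ⊕ X) ↭-refl
            (block T) R S (all-verts Ts′) rest)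
          (++⁺ˡ S (++⁺ʳ rest (↭-trans (++⁺ʳ (all-verts Ts′) p) (↭-sym (pick-concatMap-↭ verts pT))))))
        total)

      degree-S : ∀ {T Ts′} → Pick T Ts Ts′ → ∀ {u A′} → Pick u (act T) A′ →
        suc r ≡ count u S + length (block T)
      degree-S {T} {Ts′} pT {u} pu = begin-equality
        suc r
          ≡⟨ cong suc (count-split u (S ++ verts T) (↭-trans
               (↭-trans
                 (solve 4 (λ S T W X → (S ⊕ T) ⊕ W ⊕ X ⊜ S ⊕ (T ⊕ W) ⊕ X) ↭-refl
                   S (verts T) (all-verts Ts′) rest)
                 (++⁺ˡ S (++⁺ʳ rest (↭-sym (pick-concatMap-↭ verts pT)))))
               total)) ⟨
        suc (count u (S ++ verts T) + count u (all-verts Ts′ ++ rest))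
          ≡⟨ cong (λ a → suc (count u (S ++ verts T) + a)) (count-none (stuck pT pu)) ⟩
        suc (count u (S ++ verts T) + 0)
          ≡⟨ cong suc (+-identityʳ _) ⟩
        suc (count u (S ++ verts T))
          ≡⟨ cong suc (count-++ u S (verts T)) ⟩
        suc (count u S + count u (verts T))
          ≡⟨ +-suc _ _ ⟨
        count u S + suc (count u (verts T))
          ≡⟨ cong (count u S +_) (act-count T pu) ⟩
        count u S + length (block T) ∎

      1≤r : 1 ≤ r
      -- By `size` there is a class; its block is nonempty and has order at most `r`.
      1≤r with Ts | size | bound
      ... | T ∷ _ | _ | b = ≤-trans (block-inhabited T) (b here)

      -- Counted from the centres, each of which has degree `r`.
      upper : cross (all-act Ts) S ≤ length S * r
      upper with all-act-split Ts
      ... | R , p = begin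
        cross (all-act Ts) S ≡⟨ cross-comm (all-act Ts) S ⟩
        cross S (all-act Ts) ≤⟨ cross-upper S (all-act Ts) (λ u → m+n≤o⇒m≤o (count u (all-act Ts)) (≤-reflexive
          (count-split u (all-act Ts) (↭-trans
            (↭-trans
              (solve 4 (λ A R S X → A ⊕ R ⊕ S ⊕ X ⊜ S ⊕ (A ⊕ R) ⊕ X) ↭-refl
                (all-act Ts) R S rest)
              (++⁺ˡ S (++⁺ʳ rest p)))
            total)))) ⟩
        length S * r ∎

      r≤0 : r ≤ 0
      -- After cancellation, the one class in excess of `2 * length S` leaves a single `r`.
      r≤0 = +-cancelʳ-≤ (2 * (length S * r)) r 0 (begin
        r + 2 * (length S * r) ≡⟨ solveℕ 2 (λ r s → r :+ con 2 :* (s :* r) :=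
                                    (con 1 :+ (s :+ s)) :* r) refl r (length S) ⟩
        suc (length S + length S) * r ≡⟨ cong (_* r) size ⟨
        length Ts * r                 ≤⟨ cross-sum S Ts (tabulate-pick λ {T} pT →
                                           act-cross S T (bound pT) (degree-S pT)) ⟩
        2 * cross (all-act Ts) S      ≤⟨ *-monoʳ-≤ 2 upper ⟩
        2 * (length S * r)            ∎)

    -- Removing the singles

    phase : ∀ {k} m → State k m → Partition k
    phase m st with progress st
    ... | inj₂ stuck                   = ⊥-elim (not-stuck st stuck)
    ... | inj₁ (inj₁ done)             = done
    ... | inj₁ (inj₂ (m′ , refl , st′)) = phase m′ st′

    remove-single : ∀ {k} → Partition (suc k) → Partition k
    remove-single ([]     , ps , _     , p) = [] , ps , z≤n , p
    remove-single (v ∷ sg , ps , s≤s l , p) = phase (length ps)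
      -- The search starts from `v` alone, with no centres and one class: `good₁` concerns the empty
      -- list and `good₂` is vacuous.
      (state [] (solo v ∷ []) sg ps p refl l refl
        (λ { here → good-[] ; (there ()) }) (λ { here () ; (there ()) }))

    partition : ∀ k → Partition k → Good (allFin (n G))
    partition zero    ([] , ps , _ , p) = ps , p
    partition (suc k) P                 = partition k (remove-single P)

    vertices-good : Good (allFin (n G))
    vertices-good = partition (length (allFin (n G)))
      (allFin (n G) , [] , ≤-refl , ↭-reflexive (++-identityʳ _))

  -- From pieces to induced paths

  Unique-++⁻ : ∀ (xs : List V) {ys} → Unique (xs ++ ys) → Unique xs × Unique ys
  Unique-++⁻ []       u         = [] , u
  Unique-++⁻ (x ∷ xs) (x∉ ∷ u) with Unique-++⁻ xs u
  ... | uxs , uys = All.++⁻ˡ xs x∉ ∷ uxs , uys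

  induced : ∀ p → Unique (piece p) → IsInducedPath G (piece p)
  induced p@(edge x y xy) un = un , λ
    { zero       zero       → mk⇔ (λ a → ⊥-elim (~-irrefl a)) λ { (inj₁ ()) ; (inj₂ ()) }
    ; zero       (suc zero) → mk⇔ (λ _ → inj₁ refl) (λ _ → xy)
    ; (suc zero) zero       → mk⇔ (λ _ → inj₂ refl) (λ _ → ~-sym xy)
    ; (suc zero) (suc zero) → mk⇔ (λ a → ⊥-elim (~-irrefl a)) λ { (inj₁ ()) ; (inj₂ ()) }
    }
  induced p@(path x y z xy yz xz) un = un , λ
    { zero             zero             → mk⇔ (λ a → ⊥-elim (~-irrefl a)) λ { (inj₁ ()) ; (inj₂ ()) }
    ; zero             (suc zero)       → mk⇔ (λ _ → inj₁ refl) (λ _ → xy)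
    ; zero             (suc (suc zero)) → mk⇔ (λ a → ⊥-elim (xz a)) λ { (inj₁ ()) ; (inj₂ ()) }
    ; (suc zero)       zero             → mk⇔ (λ _ → inj₂ refl) (λ _ → ~-sym xy)
    ; (suc zero)       (suc zero)       → mk⇔ (λ a → ⊥-elim (~-irrefl a)) λ { (inj₁ ()) ; (inj₂ ()) }
    ; (suc zero)       (suc (suc zero)) → mk⇔ (λ _ → inj₁ refl) (λ _ → yz)
    ; (suc (suc zero)) zero             → mk⇔ (λ a → ⊥-elim (xz (~-sym a))) λ { (inj₁ ()) ; (inj₂ ()) }
    ; (suc (suc zero)) (suc zero)       → mk⇔ (λ _ → inj₂ refl) (λ _ → ~-sym yz)
    ; (suc (suc zero)) (suc (suc zero)) → mk⇔ (λ a → ⊥-elim (~-irrefl a)) λ { (inj₁ ()) ; (inj₂ ()) }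
    }

  all-induced : ∀ ps → Unique (pieces ps) → All (IsInducedPath G) (map piece ps)
  all-induced []       _ = []
  all-induced (p ∷ ps) u with Unique-++⁻ (piece p) u
  ... | up , ups = induced p up ∷ all-induced ps ups

  2≤piece : ∀ p → 2 ≤ length (piece p)
  2≤piece (edge _ _ _)       = ≤-refl
  2≤piece (path _ _ _ _ _ _) = n≤1+n 2

theorem3 : (G : Graph) (r : ℕ) → Connected G → Regular G r →
    ¬ (Complete G × Odd (n G)) → HasIPD G
theorem3 G r conn reg nc with vertices-good G conn reg nc
... | ps , p = map (piece G) ps ,
  -- The pieces together permute `allFin`, whose entries are distinct; hence so are the vertices
  -- within each path.
  (all-induced G ps (unique-↭ (↭-sym p) (allFin⁺ (n G))) , p) ,
  All.map⁺ (All.universal (2≤piece G) ps)
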